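{- The map $\phi:\bigcup_{n\ge0}\mathcal{LF}_n\to\bigcup_{n\ge0}\mathcal{IS}_{n+1}(102)$ is a bijection with $\mathrm{height}(Q)=\mathrm{rank}(\phi(Q))$ for every labeled $F$-path $Q$.
   Context: **Inversion sequences.** An inversion sequence of length $n$ is an integer sequence $e=(e_1,\dots,e_n)$ with $0\le e_j\le j-1$ for all $j$. It avoids $102$ if there are no $i<j<k$ with $e_j<e_i<e_k$; $\mathcal{IS}_n(102)$ is the set of those of length $n$ avoiding $102$. $\max(e)$ is the largest entry, and $\mathrm{fdes}(e)$ is the position $p$ of the first descent: $e_1\le\cdots\le e_p>e_{p+1}$, with the convention $e_{n+1}=-1$. For $e\in\mathcal{IS}_n(102)$ one has $e_p=\max(e)$ for $p=\mathrm{fdes}(e)$, and $\mathrm{rank}(e):=\mathrm{fdes}(e)-\max(e)-1\ge 0$. **Labeled $F$-paths.** Let $F=\{(a,1):a\ge0\}\cup\{(a,b):a\ge1,b\le0\}$ ($a,b$ integers). An $F$-path is a lattice path $(x_0,y_0)=(0,0),(x_1,y_1),\dots,(x_\ell,y_\ell)$ in $\mathbb Z^2$ not going below the line $y=x$ and all of whose steps $(x_j-x_{j-1},y_j-y_{j-1})$ lie in $F$. A labeled $F$-path is an $F$-path in which each step $(a,1)$ has label $(a;1)$, and each step $(a,b)$ with $b\le0$ has a label $(a;b_1,\dots,b_k)$ with $k\ge1$, nonpositive integers $b_i$, $b_1+\cdots+b_k=b$. A step with label $(a;b_1,\dots,b_k)$ has semilength $k$ (a step labeled $(a;1)$ has semilength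 $1$); the semilength of the path is the sum of semilengths of its steps. $\mathcal{LF}_n$ is the set of labeled $F$-paths of semilength $n$; $\mathrm{height}(Q)=y_\ell-x_\ell$. **The map $\phi$** (it sends $\mathcal{LF}_n$ into $\mathcal{IS}_{n+1}(102)$), defined recursively. The path with no steps is sent to $(0)$. For $Q$ with $\ell\ge1$ steps, let $\hat Q$ be $Q$ with its last step removed, $\hat e=\phi(\hat Q)$, $\hat p=\mathrm{fdes}(\hat e)$, and, if the last step is $(a,b)$, $m=\max(\hat e)+a$. (1) If the last label is $(a;1)$ with $a\ge 0$, $\phi(Q)$ is obtained from $\hat e$ by inserting one entry $m$ immediately after $\hat e_{\hat p}$. (2) If the last label is $(a;b_1,\dots,b_k)$ with $a\ge1$ and all $b_i\le0$, $\phi(Q)$ is obtained from $\hat e$ by inserting $k$ entries equal to $m$, immediately after the entries $\hat e_{j_1},\dots,\hat e_{j_k}$, where $j_1=\hat p+b_1+\cdots+b_k-1$ and $j_i=\hat p+b_i+\cdots+b_k$ for $2\le i\le k$ (coinciding $j_i$'s mean multiple insertions at the same place). -}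

module Defs where

open import Data.Bool.Base using (if_then_else_)
open import Data.Fin.Base as Fin using (Fin; toℕ)
open import Data.Integer.Base as ℤ using (ℤ; +_; ∣_∣; 0ℤ; 1ℤ; NonPositive)
import Data.Integer.Properties as ℤₚ
open import Data.Irrelevant using ([_])
open import Data.List.Base using (List; []; _∷_; _++_; foldr; length; lookup; take; drop)
open import Data.List.Extrema.Nat using (max)
open import Data.List.NonEmpty.Base as List⁺ using (List⁺; _∷_)
open import Data.Nat.Base as ℕ using (ℕ; suc; NonZero)
import Data.Nat.Properties as ℕₚ
open import Data.Product.Base using (Σ; _×_; _,_; Σ-syntax; map₂)
open import Data.Refinement.Base as Refinement using (Refinement; Refinement-syntax; value; _,_)
open import Data.Sum.Base using (_⊎_; inj₁; inj₂)
open import Relation.Binary.PropositionalEquality.Core using (_≡_; refl)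
open import Relation.Nullary.Decidable.Core using (does)
open import Relation.Nullary.Negation.Core using (¬_)
open import Relation.Unary using (IUniversal; _⇒_; _⊢_)

-- `lookup e` is 0-based: lookup e j is the entry e_{j+1}, so the bound
-- e_{j+1} ≤ (j+1) - 1 is  lookup e j ≤ toℕ j.

IsInversionSequence : List ℕ → Set
IsInversionSequence e = ∀ (j : Fin (length e)) → lookup e j ℕ.≤ toℕ j

Avoids102 : List ℕ → Set
Avoids102 e = ∀ (i j k : Fin (length e)) → i Fin.< j → j Fin.< k →
  ¬ (lookup e j ℕ.< lookup e i × lookup e i ℕ.< lookup e k)

IsIS102 : ℕ → List ℕ → Set
IsIS102 n e = length e ≡ n × IsInversionSequence e × Avoids102 e

-- Refinement types carry irrelevant proofs, so _≡_ compares only the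
-- underlying sequences.

IS102 : ℕ → Set
IS102 n = [ e ∈ List ℕ ∣ IsIS102 n e ]

-- Entries are nonnegative, so the base value 0 does not affect the maximum
-- of a nonempty sequence.

maxEntry : List ℕ → ℕ
maxEntry = max 0

-- The 1-based position of the first descent; the singleton clause is the
-- convention e_{n+1} = -1.  The value on [] is junk.

fdes : List ℕ → ℕ
fdes []          = 0
fdes (x ∷ [])    = 1
fdes (x ∷ y ∷ e) = if does (y ℕₚ.<? x) then 1 else suc (fdes (y ∷ e))

rank : List ℕ → ℤ
rank e = + fdes e ℤ.- + maxEntry e ℤ.- 1ℤ

F : ℤ × ℤ → Set
F (a , b) = (0ℤ ℤ.≤ a × b ≡ 1ℤ) ⊎ (1ℤ ℤ.≤ a × b ℤ.≤ 0ℤ)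

ℤ≤0 : Set
ℤ≤0 = [ b ∈ ℤ ∣ NonPositive b ]

sum : List ℤ≤0 → ℤ
sum = foldr (λ b s → value b ℤ.+ s) 0ℤ

-- rise a  is the label (a;1);  fall a (b₁ ∷ … ∷ b_k)  is (a;b₁,…,b_k).
-- A label determines the step that carries it.

data Label : Set where
  rise : (a : ℕ) → Label
  fall : (a : ℕ) .{{_ : NonZero a}} (bs : List⁺ ℤ≤0) → Label

step : Label → ℤ × ℤ
step (rise a)    = + a , 1ℤ
step (fall a bs) = + a , sum (List⁺.toList bs)

sum≤0 : ∀ bs → sum bs ℤ.≤ 0ℤ
sum≤0 []                   = ℤₚ.≤-refl
sum≤0 ((b , [ b≤0 ]) ∷ bs) =
  ℤₚ.+-mono-≤ (ℤₚ.nonPositive⁻¹ b {{b≤0}}) (sum≤0 bs)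

step∈F : ∀ l → F (step l)
step∈F (rise a)    = inj₁ (ℤ.+≤+ ℕ.z≤n , refl)
step∈F (fall a bs) = inj₂ (ℤ.+≤+ (ℕ.>-nonZero⁻¹ a) , sum≤0 (List⁺.toList bs))

labelSemilength : Label → ℕ
labelSemilength (rise a)    = 1
labelSemilength (fall a bs) = List⁺.length bs

-- A labeled path from the origin, with its last step outermost.

infixl 5 _▷_

data Path : Set where
  ε   : Path
  _▷_ : Path → Label → Path

endpoint : Path → ℤ × ℤ
endpoint ε       = 0ℤ , 0ℤ
endpoint (Q ▷ l) =
  let (x , y) = endpoint Q
      (a , b) = step l
  in  x ℤ.+ a , y ℤ.+ b

WeaklyAbove : ℤ × ℤ → Set
WeaklyAbove (x , y) = x ℤ.≤ y

data NotBelowDiagonal : Path → Set where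
  start : NotBelowDiagonal ε
  next  : ∀ {Q l} → NotBelowDiagonal Q → WeaklyAbove (endpoint (Q ▷ l)) →
          NotBelowDiagonal (Q ▷ l)

semilength : Path → ℕ
semilength ε       = 0
semilength (Q ▷ l) = semilength Q ℕ.+ labelSemilength l

height : Path → ℤ
height Q = let (x , y) = endpoint Q in y ℤ.- x

IsLF : ℕ → Path → Set
IsLF n Q = NotBelowDiagonal Q × semilength Q ≡ n

LF : ℕ → Set
LF n = [ Q ∈ Path ∣ IsLF n Q ]

-- The position j is 1-based.

insertAfter : ℕ → ℕ → List ℕ → List ℕ
insertAfter m j e = take j e ++ m ∷ drop j e

-- For j₁ ≤ … ≤ j_k, inserts m after each of the j_i-th entries of e.  The
-- rightmost insertion is done first, so that every j_i still refers to the
-- positions of e itself.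

insertAllAfter : ℕ → List ℕ → List ℕ → List ℕ
insertAllAfter m js e = foldr (insertAfter m) e js

-- laterPositions p (b_i ∷ … ∷ b_k) lists p + b_i + … + b_k, …, p + b_k.
-- On a path not below the diagonal the integers under ∣_∣ here and in
-- `positions` are positive, so ∣_∣ only converts them to ℕ.

laterPositions : ℕ → List ℤ≤0 → List ℕ
laterPositions p []       = []
laterPositions p (b ∷ bs) = ∣ + p ℤ.+ sum (b ∷ bs) ∣ ∷ laterPositions p bs

positions : ℕ → List⁺ ℤ≤0 → List ℕ
positions p (b ∷ bs) = ∣ + p ℤ.+ sum (b ∷ bs) ℤ.- 1ℤ ∣ ∷ laterPositions p bs

extend : List ℕ → Label → List ℕ
extend e (rise a)    = insertAfter (maxEntry e ℕ.+ a) (fdes e) e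
extend e (fall a bs) = insertAllAfter (maxEntry e ℕ.+ a) (positions (fdes e) bs) e

φ : Path → List ℕ
φ ε       = 0 ∷ []
φ (Q ▷ l) = extend (φ Q) l

⋃LF : Set
⋃LF = Σ[ n ∈ ℕ ] LF n

⋃IS102 : Set
⋃IS102 = Σ[ n ∈ ℕ ] IS102 (suc n)

MapsLFtoIS102 : Set
MapsLFtoIS102 = ∀ n → ∀[ IsLF n ⇒ φ ⊢ IsIS102 (suc n) ]

φ-on-⋃LF : MapsLFtoIS102 → ⋃LF → ⋃IS102
φ-on-⋃LF wd = map₂ (λ {n} → Refinement.map φ (wd n))

{-# OPTIONS --safe #-}

-- A 102-avoiding sequence climbs weakly to its maximum m at its first descent
-- p, and every later copy of a new maximum must be preceded only by a weakly
-- increasing run of smaller entries.  So the last step of a path can be read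
-- off the sequence: if the entry before position p is also m, the step is
-- (0;1) and deleting the entry at p undoes it.  Otherwise a ≥ 1, deleting all
-- copies of m recovers the previous sequence, the positions they are deleted
-- from are j₁ < j₂ ≤ … ≤ j_k ≤ p̂, and these encode the label: the b_i are
-- differences of consecutive positions, except that k = 1, j₁ = p̂ is (a;1).

module Submission where

open import Defs
open import Data.Fin.Base as Fin using (Fin; zero; suc; toℕ)
open import Data.Integer.Base as ℤ using (ℤ; +_; -[1+_]; ∣_∣; 0ℤ; 1ℤ)
import Data.Integer.Properties as ℤₚ
open import Data.Integer.Tactic.RingSolver using (solve-∀)
open import Data.Irrelevant using ([_])
open import Data.List.Base using (List; []; _∷_; _∷ʳ_; _++_; length; lookup; take; drop)
open import Data.List.Extrema.Nat using (max≈v⁺)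
open import Data.List.Membership.Propositional using (_∈_)
open import Data.List.Membership.Propositional.Properties using (∈-lookup)
open import Data.List.NonEmpty.Base using (_∷_)
import Data.List.Properties as List
open import Data.List.Relation.Unary.All as All using (All; []; _∷_)
open import Data.List.Relation.Unary.AllPairs using (AllPairs; []; _∷_)
open import Data.List.Relation.Unary.AllPairs.Properties using (tabulate⁺-<)
open import Data.List.Relation.Unary.Any using (here; there)
open import Data.Nat.Base using
  (ℕ; zero; suc; _+_; _∸_; _≤_; _<_; z≤n; s≤s; s≤s⁻¹; NonZero; >-nonZero; >-nonZero⁻¹)
open import Data.Nat.Properties
open import Data.Product.Base using (Σ; Σ-syntax; ∃-syntax; ∃₂; _×_; _,_; proj₁; proj₂)
open import Data.Refinement.Base using (value; _,_)
open import Data.Refinement.Properties using (value-injective)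
open import Data.Sum.Base using (inj₁; inj₂)
open import Function.Base using (_∘_)
open import Function.Consequences.Propositional using (strictlySurjective⇒surjective)
open import Function.Definitions using (Bijective; Injective; StrictlySurjective)
open import Relation.Binary.PropositionalEquality.Core
  using (_≡_; _≢_; refl; sym; trans; cong; cong₂; subst)
open import Relation.Binary.PropositionalEquality.Properties using (module ≡-Reasoning)
open import Relation.Nullary using (¬_; recompute; yes; no; contradiction)
open import Relation.Nullary.Decidable using (dec-true; dec-false)
open import Relation.Nullary.Recomputable
  using (Recomputable; _×-recompute_; Π-recompute; ¬-recompute)

private
  variable
    i j k m n p q u v x y z : ℕ
    a c q′ : ℕ
    b : ℤ≤0
    bs bs′ : List ℤ≤0
    l l′ : Label
    Q Q′ : Path
    e e′ e₁ e₂ js js₁ js₂ : List ℕ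

-- Inductive forms of the conditions on sequences.

-- The index counts the entries already passed, so `Bounded 0` is the inversion-sequence condition
-- in a form that survives taking tails.
data Bounded : ℕ → List ℕ → Set where
  []  : Bounded i []
  _∷_ : x ≤ i → Bounded (suc i) e → Bounded i (x ∷ e)

-- Here `x` is a candidate for the 1 of a 102 pattern and the list is what follows it.
No02Around : ℕ → List ℕ → Set
No02Around x = AllPairs (λ y z → ¬ (y < x × x < z))

data Avoiding : List ℕ → Set where
  []  : Avoiding []
  _∷_ : No02Around x e → Avoiding e → Avoiding (x ∷ e)

-- In Peak, Summit and Insertion the list e is what remains of a longer list
-- after its first i entries, and p and the entries of js are positions in the
-- longer list, so they stay constant along the recursion.  Summit also records
-- the entry u just before the peak.

data Peak : (i p v : ℕ) → List ℕ → Set where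
  end     : Peak i (suc i) x (x ∷ [])
  descend : y < x → Peak i (suc i) x (x ∷ y ∷ e)
  climb   : x ≤ y → Peak (suc i) p v (y ∷ e) → Peak i p v (x ∷ y ∷ e)

data Summit : (i p u v : ℕ) → List ℕ → Set where
  top   : u ≤ v → Peak (suc i) (suc (suc i)) v (v ∷ e) →
          Summit i (suc (suc i)) u v (u ∷ v ∷ e)
  climb : x ≤ y → Summit (suc i) p u v (y ∷ e) → Summit i p u v (x ∷ y ∷ e)

data Insertion (m : ℕ) : (i : ℕ) (js e e′ : List ℕ) → Set where
  done  : Insertion m i [] [] []
  here  : Insertion m i js e e′ → Insertion m i (i ∷ js) e (m ∷ e′)
  there : Insertion m (suc i) js e e′ → Insertion m i js (x ∷ e) (x ∷ e′)

-- First descent, maximum and the entry before the peak.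

peak-exists : ∀ i x e → ∃₂ λ p v → Peak i p v (x ∷ e)
peak-exists i x []      = suc i , x , end
peak-exists i x (y ∷ e) with y <? x
... | yes y<x = suc i , x , descend y<x
... | no  y≮x = let (p , v , P) = peak-exists (suc i) y e in p , v , climb (≮⇒≥ y≮x) P

peak⇒i<p : Peak i p v e → i < p
peak⇒i<p end         = ≤-refl
peak⇒i<p (descend _)    = ≤-refl
peak⇒i<p (climb _ P) = <-trans (n<1+n _) (peak⇒i<p P)

peak⇒p≤i+length : Peak i p v e → p ≤ i + length e
peak⇒p≤i+length {i} end         = ≤-reflexive (+-comm 1 i)
peak⇒p≤i+length {i} (descend _)    = ≤-trans (≤-reflexive (+-comm 1 i)) (+-monoʳ-≤ i (s≤s z≤n))
peak⇒p≤i+length {i} (climb _ P) = ≤-trans (peak⇒p≤i+length P) (≤-reflexive (sym (+-suc i _)))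

peak⇒head≤v : Peak i p v (x ∷ e) → x ≤ v
peak⇒head≤v end           = ≤-refl
peak⇒head≤v (descend _)      = ≤-refl
peak⇒head≤v (climb x≤y P) = ≤-trans x≤y (peak⇒head≤v P)

peak⇒v∈e : Peak i p v e → v ∈ e
peak⇒v∈e end         = here refl
peak⇒v∈e (descend _)    = here refl
peak⇒v∈e (climb _ P) = there (peak⇒v∈e P)

-- The peak is the entry at position `p`, where the bound is `p - 1`. This is nonnegativity of the
-- rank.
peak⇒v<p : Peak i p v e → Bounded i e → v < p
peak⇒v<p end         (x≤i ∷ _) = s≤s x≤i
peak⇒v<p (descend _)    (x≤i ∷ _) = s≤s x≤i
peak⇒v<p (climb _ P) (_ ∷ B)   = peak⇒v<p P B

-- Entries before the peak climb to it; after the descent from `x` to `y`, a later entry above `x`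
-- would complete a 102 pattern.
peak⇒all≤v : Peak i p v e → Avoiding e → All (_≤ v) e
peak⇒all≤v end           _                = ≤-refl ∷ []
peak⇒all≤v (descend y<x)    ((¬yxz ∷ _) ∷ _) =
  ≤-refl ∷ <⇒≤ y<x ∷ All.map (λ ¬yxz → ≮⇒≥ (λ x<z → ¬yxz (y<x , x<z))) ¬yxz
peak⇒all≤v (climb x≤y P) (_ ∷ A)          = ≤-trans x≤y (peak⇒head≤v P) ∷ peak⇒all≤v P A

peak⇒fdes : Peak i p v e → i + fdes e ≡ p
peak⇒fdes {i} end = +-comm i 1
peak⇒fdes {i} (descend {y = y} {x = x} y<x) rewrite dec-true (y <? x) y<x = +-comm i 1
peak⇒fdes {i} (climb {x = x} {y = y} x≤y P) rewrite dec-false (y <? x) (≤⇒≯ x≤y) =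
  trans (+-suc i _) (peak⇒fdes P)

summit⇒peak : Summit i p u v e → Peak i p v e
summit⇒peak (top u≤v P)   = climb u≤v P
summit⇒peak (climb x≤y S) = climb x≤y (summit⇒peak S)

summit⇒u≤v : Summit i p u v e → u ≤ v
summit⇒u≤v (top u≤v _) = u≤v
summit⇒u≤v (climb _ S) = summit⇒u≤v S

summit⇒1+i<p : Summit i p u v e → suc i < p
summit⇒1+i<p (top _ _)   = ≤-refl
summit⇒1+i<p (climb _ S) = <-trans (n<1+n _) (summit⇒1+i<p S)

summit⇒head≤u : Summit i p u v (x ∷ e) → x ≤ u
summit⇒head≤u (top _ _)     = ≤-refl
summit⇒head≤u (climb x≤y S) = ≤-trans x≤y (summit⇒head≤u S)

summit-unique : Summit i p u v e → Summit i p x v e → u ≡ x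
summit-unique (top _ _)   (top _ _)   = refl
summit-unique (top _ _)   (climb _ S) = contradiction (summit⇒1+i<p S) (n≮n _)
summit-unique (climb _ S) (top _ _)   = contradiction (summit⇒1+i<p S) (n≮n _)
summit-unique (climb _ S) (climb _ T) = summit-unique S T

-- The ascent `x ≤ y` keeps the first descent off the first entry. In an inversion sequence it is
-- automatic, since there `x` is 0.
peak⇒summit : Peak i p v (x ∷ y ∷ e) → x ≤ y → ∃[ u ] Summit i p u v (x ∷ y ∷ e)
peak⇒summit (descend y<x)                x≤y = contradiction x≤y (<⇒≱ y<x)
peak⇒summit (climb _ end)             x≤y = _ , top x≤y end
peak⇒summit (climb _ (descend z<y))      x≤y = _ , top x≤y (descend z<y)
peak⇒summit (climb _ P@(climb y≤z _)) x≤y =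
  let (u , S) = peak⇒summit P y≤z in u , climb x≤y S

-- Insertion and removal of copies of one value.

insertion⇒≥ : Insertion m i js e e′ → All (i ≤_) js
insertion⇒≥ done        = []
insertion⇒≥ (here I)    = ≤-refl ∷ insertion⇒≥ I
insertion⇒≥ (there I)   = All.map (≤-trans (n≤1+n _)) (insertion⇒≥ I)

insertion⇒sorted : Insertion m i js e e′ → AllPairs _≤_ js
insertion⇒sorted done      = []
insertion⇒sorted (here I)  = insertion⇒≥ I ∷ insertion⇒sorted I
insertion⇒sorted (there I) = insertion⇒sorted I

insertion⇒length : Insertion m i js e e′ → length e′ ≡ length e + length js
insertion⇒length done      = refl
insertion⇒length (here I)  = trans (cong suc (insertion⇒length I)) (sym (+-suc _ _))
insertion⇒length (there I) = cong suc (insertion⇒length I)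

insertion-[]⇒≡ : Insertion m i [] e e′ → e ≡ e′
insertion-[]⇒≡ done      = refl
insertion-[]⇒≡ (there I) = cong (_ ∷_) (insertion-[]⇒≡ I)

≡⇒insertion-[] : ∀ e → Insertion m i [] e e
≡⇒insertion-[] []      = done
≡⇒insertion-[] (x ∷ e) = there (≡⇒insertion-[] e)

insertion-beyond⇒≡ : Insertion m (suc i) js e e′ → All (_≤ i) js → e ≡ e′
insertion-beyond⇒≡ {js = []}    I _         = insertion-[]⇒≡ I
insertion-beyond⇒≡ {js = _ ∷ _} I (j≤i ∷ _) with insertion⇒≥ I
... | i<j ∷ _ = contradiction j≤i (<⇒≱ i<j)

insertion-exists : ∀ m i js e → AllPairs _≤_ js → All (i ≤_) js →
                   All (_≤ i + length e) js → ∃[ e′ ] Insertion m i js e e′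
insertion-exists m i []       e _ _ _ = e , ≡⇒insertion-[] e
insertion-exists m i (j ∷ js) e (j≤js ∷ js↗) (i≤j ∷ i≤js) (j≤ ∷ js≤)
  with m≤n⇒m<n∨m≡n i≤j
insertion-exists m i (j ∷ js) e (j≤js ∷ js↗) (i≤j ∷ i≤js) (j≤ ∷ js≤) | inj₂ refl =
  let (e′ , I) = insertion-exists m i js e js↗ i≤js js≤ in m ∷ e′ , here I
insertion-exists m i (j ∷ js) [] _ _ (j≤ ∷ _) | inj₁ i<j =
  contradiction (subst (j ≤_) (+-identityʳ i) j≤) (<⇒≱ i<j)
insertion-exists m i (j ∷ js) (x ∷ e) js↗@(j≤js ∷ _) _ js≤ | inj₁ i<j =
  let (e′ , I) = insertion-exists m (suc i) (j ∷ js) e js↗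
                   (i<j ∷ All.map (≤-trans i<j) j≤js)
                   (All.map (λ {k} → subst (k ≤_) (+-suc i _)) js≤)
  in x ∷ e′ , there I

take-++-length : ∀ (e₁ e₂ : List ℕ) → take (length e₁) (e₁ ++ e₂) ≡ e₁
take-++-length []       e₂ = refl
take-++-length (x ∷ e₁) e₂ = cong (x ∷_) (take-++-length e₁ e₂)

drop-++-length : ∀ (e₁ e₂ : List ℕ) → drop (length e₁) (e₁ ++ e₂) ≡ e₂
drop-++-length []       e₂ = refl
drop-++-length (x ∷ e₁) e₂ = drop-++-length e₁ e₂

-- The prefix `d` holds the `i` entries already passed, which absolute positions count. Later
-- insertions are done first and leave `d` intact, so the insertion at `i` splits just after `d`.
insertion⇒insertAllAfter : ∀ d → length d ≡ i → Insertion m i js e e′ →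
                           insertAllAfter m js (d ++ e) ≡ d ++ e′
insertion⇒insertAllAfter d _ done = refl
insertion⇒insertAllAfter {m = m} {e = e} d refl (here {e′ = e′} I)
  rewrite insertion⇒insertAllAfter d refl I =
  cong₂ (λ s t → s ++ m ∷ t) (take-++-length d e′) (drop-++-length d e′)
insertion⇒insertAllAfter {m = m} {js = js} d refl (there {e = e} {e′ = e′} {x = x} I) =
  trans (cong (insertAllAfter m js) (sym (List.++-assoc d (x ∷ []) e)))
 (trans (insertion⇒insertAllAfter (d ∷ʳ x) (trans (List.length-++ d) (+-comm _ 1)) I)
        (List.++-assoc d (x ∷ []) e′))

insertion-source-unique : Insertion m i js e₁ e′ → Insertion m i js e₂ e′ → e₁ ≡ e₂
insertion-source-unique done      done      = refl
insertion-source-unique (here I)  (here J)  = insertion-source-unique I J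
insertion-source-unique (here I)  (there J) = contradiction (All.head (insertion⇒≥ J)) (n≮n _)
insertion-source-unique (there I) (here J)  = contradiction (All.head (insertion⇒≥ I)) (n≮n _)
insertion-source-unique (there I) (there J) = cong (_ ∷_) (insertion-source-unique I J)

-- With all source entries below `m`, the copies of `m` in `e′` are exactly the inserted ones.
removal-unique : All (_< m) e₁ → All (_< m) e₂ → Insertion m i js₁ e₁ e′ →
                 Insertion m i js₂ e₂ e′ → js₁ ≡ js₂ × e₁ ≡ e₂
removal-unique _          _          done      done      = refl , refl
removal-unique <m₁        <m₂        (here I)  (here J)  =
  let (js≡ , e≡) = removal-unique <m₁ <m₂ I J in cong (_ ∷_) js≡ , e≡
removal-unique _          (m<m ∷ _)  (here I)  (there J) = contradiction m<m (n≮n _)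
removal-unique (m<m ∷ _)  _          (there I) (here J)  = contradiction m<m (n≮n _)
removal-unique (_ ∷ <m₁)  (_ ∷ <m₂)  (there I) (there J) =
  let (js≡ , e≡) = removal-unique <m₁ <m₂ I J in js≡ , cong (_ ∷_) e≡

removal-exists : ∀ i → All (_≤ m) e′ → ∃₂ λ js e → Insertion m i js e e′ × All (_< m) e
removal-exists i [] = [] , [] , done , []
removal-exists i (x≤m ∷ ≤m) with m≤n⇒m<n∨m≡n x≤m
... | inj₁ x<m  = let (js , e , I , <m) = removal-exists (suc i) ≤m
                  in js , _ ∷ e , there I , x<m ∷ <m
... | inj₂ refl = let (js , e , I , <m) = removal-exists i ≤m
                  in i ∷ js , e , here I , <m

-- Boundedness and avoidance under insertion and removal.

insertion-all : ∀ {P : ℕ → Set} → Insertion m i js e e′ → P m → All P e → All P e′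
insertion-all done      _  []        = []
insertion-all (here I)  pm pe        = pm ∷ insertion-all I pm pe
insertion-all (there I) pm (px ∷ pe) = px ∷ insertion-all I pm pe

removal-all : ∀ {P : ℕ → Set} → Insertion m i js e e′ → All P e′ → All P e
removal-all done      []        = []
removal-all (here I)  (_ ∷ pe)  = removal-all I pe
removal-all (there I) (px ∷ pe) = px ∷ removal-all I pe

removal-allPairs : ∀ {R : ℕ → ℕ → Set} → Insertion m i js e e′ → AllPairs R e′ → AllPairs R e
removal-allPairs done      []        = []
removal-allPairs (here I)  (_ ∷ pe)  = removal-allPairs I pe
removal-allPairs (there I) (px ∷ pe) = removal-all I px ∷ removal-allPairs I pe

removal-avoiding : Insertion m i js e e′ → Avoiding e′ → Avoiding e
removal-avoiding done      []      = []
removal-avoiding (here I)  (_ ∷ A) = removal-avoiding I A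
removal-avoiding (there I) (r ∷ A) = removal-allPairs I r ∷ removal-avoiding I A

all≤⇒bounded : All (_≤ i) e → Bounded i e
all≤⇒bounded []         = []
all≤⇒bounded (x≤i ∷ ≤i) = x≤i ∷ all≤⇒bounded (All.map m≤n⇒m≤1+n ≤i)

-- Removal moves entries left, to tighter bounds. But the first removed `m` met the bound at its own
-- place, and all entries after it are at most `m`.
removal-bounded : Insertion m i js e e′ → All (_≤ m) e → Bounded i e′ → Bounded i e
removal-bounded done      _        []        = []
removal-bounded (here I)  ≤m       (m≤i ∷ _) = all≤⇒bounded (All.map (λ x≤m → ≤-trans x≤m m≤i) ≤m)
removal-bounded (there I) (_ ∷ ≤m) (x≤i ∷ B) = x≤i ∷ removal-bounded I ≤m B

-- While `i` counts source entries passed, `q` counts target entries. Old entries only move right,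
-- and a copy of `m` at `j` fits because `m ≤ j ≤ q`.
insertion-bounded : Insertion m i js e e′ → i ≤ q → All (m ≤_) js → Bounded i e → Bounded q e′
insertion-bounded done      _   _            []        = []
insertion-bounded (here I)  i≤q (m≤i ∷ m≤js) B         =
  ≤-trans m≤i i≤q ∷ insertion-bounded I (m≤n⇒m≤1+n i≤q) m≤js B
insertion-bounded (there I) i≤q m≤js         (x≤i ∷ B) =
  ≤-trans x≤i i≤q ∷ insertion-bounded I (s≤s i≤q) m≤js B

-- The climb of a `Peak` without its value and descent: `x` is the entry just passed, and nothing is
-- required past position `p`.
data Ascending : (x i p : ℕ) → List ℕ → Set where
  beyond : p ≤ i → Ascending x i p e
  _∷_    : x ≤ y → Ascending y (suc i) p e → Ascending x i p (y ∷ e)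

peak⇒ascending : Peak i p v (x ∷ e) → Ascending x (suc i) p e
peak⇒ascending end           = beyond ≤-refl
peak⇒ascending (descend _)      = beyond ≤-refl
peak⇒ascending (climb x≤y P) = x≤y ∷ peak⇒ascending P

-- Up to position `p` all entries, and the copies of `m`, are at least `x`, so none is the 0 of a
-- pattern with `x` as 1. Beyond `p` nothing is inserted.
insertion-no02Around : Insertion m i js e e′ → All (_≤ p) js → Ascending y i p e → x ≤ y → x ≤ m →
                       No02Around x e → No02Around x e′
insertion-no02Around done _ _ _ _ [] = []
insertion-no02Around (here I) (_ ∷ js≤p) asc x≤y x≤m r =
  All.universal (λ _ (m<x , _) → <⇒≱ m<x x≤m) _ ∷ insertion-no02Around I js≤p asc x≤y x≤m r
insertion-no02Around (there I) js≤p (beyond p≤i) x≤y x≤m r =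
  subst (No02Around _ ∘ (_ ∷_)) (insertion-beyond⇒≡ I (All.map (λ j≤p → ≤-trans j≤p p≤i) js≤p)) r
insertion-no02Around (there I) js≤p (y≤z ∷ asc) x≤y x≤m (_ ∷ r) =
  All.universal (λ _ (z<x , _) → <⇒≱ z<x (≤-trans x≤y y≤z)) _ ∷
  insertion-no02Around I js≤p asc (≤-trans x≤y y≤z) x≤m r

all≤⇒no02Around : All (_≤ x) e → No02Around x e
all≤⇒no02Around []         = []
all≤⇒no02Around (_ ∷ ≤x) = All.map (λ z≤x (_ , x<z) → <⇒≱ x<z z≤x) ≤x ∷ all≤⇒no02Around ≤x

-- A copy of `m` is never the 1 of a pattern, as no entry exceeds it; for old entries
-- `insertion-no02Around` applies.
insertion-avoiding : Insertion m i js e e′ → All (_≤ p) js → Ascending y i p e → All (_≤ m) e →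
                     Avoiding e → Avoiding e′
insertion-avoiding done      _          _            _          []      = []
insertion-avoiding (here I)  (_ ∷ js≤p) asc          ≤m         A       =
  all≤⇒no02Around (insertion-all I ≤-refl ≤m) ∷ insertion-avoiding I js≤p asc ≤m A
insertion-avoiding (there I) js≤p       (beyond p≤i) _          A       =
  subst (Avoiding ∘ (_ ∷_)) (insertion-beyond⇒≡ I (All.map (λ j≤p → ≤-trans j≤p p≤i) js≤p)) A
insertion-avoiding (there I) js≤p       (_ ∷ asc)    (x≤m ∷ ≤m) (r ∷ A) =
  insertion-no02Around I js≤p asc ≤-refl x≤m r ∷ insertion-avoiding I js≤p asc ≤m A

insertion-into-[]⇒≤ : Insertion m i js [] e′ → All (_≤ i) js
insertion-into-[]⇒≤ done     = []
insertion-into-[]⇒≤ (here I) = ≤-refl ∷ insertion-into-[]⇒≤ I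

insertion-absent⇒[] : ∀ {P : ℕ → Set} → Insertion m i js e e′ → ¬ P m → All P e′ → js ≡ []
insertion-absent⇒[] done      _   _        = refl
insertion-absent⇒[] (here I)  ¬Pm (pm ∷ _) = contradiction pm ¬Pm
insertion-absent⇒[] (there I) ¬Pm (_ ∷ pe) = insertion-absent⇒[] I ¬Pm pe

insertion-below⇒≤ : Insertion m i js (y ∷ e) e′ → y < x → x < m → No02Around x e′ → All (_≤ i) js
insertion-below⇒≤ (here I)  y<x x<m (_ ∷ r) = ≤-refl ∷ insertion-below⇒≤ I y<x x<m r
insertion-below⇒≤ (there I) y<x x<m (r ∷ _)
  rewrite insertion-absent⇒[] I (λ ¬yxm → ¬yxm (y<x , x<m)) r = []

-- Past the first descent, the peak and the smaller entry after it would be the 1 and 0 of a pattern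
-- with any copy of `m`.
insertion-avoiding⇒≤p : Insertion m i js e e′ → All (_< m) e → Peak i p v e → Avoiding e′ → All (_≤ p) js
insertion-avoiding⇒≤p (here I)  <m         P           (_ ∷ A) =
  <⇒≤ (peak⇒i<p P) ∷ insertion-avoiding⇒≤p I <m P A
insertion-avoiding⇒≤p (there I) _          end         _       = insertion-into-[]⇒≤ I
insertion-avoiding⇒≤p (there I) (x<m ∷ _)  (descend y<x)  (r ∷ _) = insertion-below⇒≤ I y<x x<m r
insertion-avoiding⇒≤p (there I) (_ ∷ <m)   (climb _ P) (_ ∷ A) = insertion-avoiding⇒≤p I <m P A

-- The peak before and after an insertion.

level-insertion⇒summit : Insertion v i (p ∷ []) e e′ → Peak i p v e → Summit i (suc p) v v e′
level-insertion⇒summit (here I) P = contradiction (peak⇒i<p P) (n≮n _)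
level-insertion⇒summit (there (here done)) end = top ≤-refl end
level-insertion⇒summit (there (here I)) (descend y<x) with refl ← insertion-[]⇒≡ I =
  top ≤-refl (descend y<x)
level-insertion⇒summit (there (there I)) (descend y<x) =
  contradiction (All.head (insertion⇒≥ I)) (n≮n _)
level-insertion⇒summit (there (here I)) (climb _ P) = contradiction (peak⇒i<p P) (n≮n _)
level-insertion⇒summit (there I@(there _)) (climb x≤y P) =
  climb x≤y (level-insertion⇒summit I P)

jump-insertion⇒peak : Insertion m i js e e′ → All (_< m) e → All (i <_) js → Peak i (suc i) m (m ∷ e′)
jump-insertion⇒peak done      _         _         = end
jump-insertion⇒peak (here I)  _         (i<i ∷ _) = contradiction i<i (n≮n _)
jump-insertion⇒peak (there I) (y<m ∷ _) _         = descend y<m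

-- As `j ≤ p`, the first copy of `m` lands within the climb or right after it; as `j < js`, it is
-- followed by an entry below `m` or by the end. So it is the new peak.
jump-insertion⇒summit : Insertion m i (j ∷ js) e e′ → All (_< m) e → Peak i p v e →
                        i < j → All (j <_) js → j ≤ p →
                        ∃[ u ] u < m × Summit i (suc j) u m e′
jump-insertion⇒summit (here I) _ _ i<i _ _ = contradiction i<i (n≮n _)
jump-insertion⇒summit (there (here I)) (x<m ∷ <m) _ _ j<js _ =
  _ , x<m , top (<⇒≤ x<m) (jump-insertion⇒peak I <m j<js)
jump-insertion⇒summit (there (there I)) _ (descend _) _ _ j≤p =
  contradiction (All.head (insertion⇒≥ I)) (≤⇒≯ j≤p)
jump-insertion⇒summit (there I@(there I′)) (_ ∷ <m) (climb x≤y P) _ j<js j≤p =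
  let (u , u<m , S) = jump-insertion⇒summit I <m P (All.head (insertion⇒≥ I′)) j<js j≤p
  in u , u<m , climb x≤y S

summit⇒level-insertion : Summit i p m m e′ →
  ∃₂ λ q e → p ≡ suc q × Insertion m i (q ∷ []) e e′ × Peak i q m e
summit⇒level-insertion (top _ end) = _ , _ , refl , there (here done) , end
summit⇒level-insertion (top _ (descend y<m)) =
  _ , _ , refl , there (here (≡⇒insertion-[] _)) , descend y<m
summit⇒level-insertion (top _ (climb _ P)) = contradiction (peak⇒i<p P) (n≮n _)
summit⇒level-insertion (climb x≤y S) with summit⇒level-insertion S
... | q , _ , p≡ , I@(there _) , P = q , _ , p≡ , there I , climb x≤y P
... | q , _ , p≡ , here I , P = contradiction (peak⇒i<p P) (n≮n _)

-- Entries before the summit are at most `u < m`, so the first copy of `m` is the peak; a second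
-- copy right after it would prolong the climb, hence the strict `j < js′`.
summit⇒jump-insertion : Insertion m i js e e′ → All (_< m) e → Summit i p u m e′ → u < m →
  ∃₂ λ j js′ → js ≡ j ∷ js′ × p ≡ suc j × All (j <_) js′
summit⇒jump-insertion (here I) _ S u<m = contradiction (summit⇒head≤u S) (<⇒≱ u<m)
summit⇒jump-insertion (there (there I)) (_ ∷ m<m ∷ _) (top _ P) _ = contradiction m<m (n≮n _)
summit⇒jump-insertion (there (here done)) _ (top _ _) _ = _ , _ , refl , refl , []
summit⇒jump-insertion (there (here (here I))) _ (top _ (descend m<m)) _ = contradiction m<m (n≮n _)
summit⇒jump-insertion (there (here (here I))) _ (top _ (climb _ P)) _ =
  contradiction (peak⇒i<p P) (n≮n _)
summit⇒jump-insertion (there (here (there I))) _ (top _ _) _ = _ , _ , refl , refl , insertion⇒≥ I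
summit⇒jump-insertion (there I) (_ ∷ <m) (climb _ S) u<m = summit⇒jump-insertion I <m S u<m

-- Labels and lists of insertion positions.

neg : ℕ → ℤ≤0
neg c = ℤ.- (+ c) , [ ℤ.nonPositive (ℤₚ.neg-mono-≤ (ℤ.+≤+ (z≤n {c}))) ]

neg-surjective : ∀ b → ∃[ c ] b ≡ neg c
neg-surjective (b , [ b≤0 ]) =
  ∣ b ∣ , value-injective (≤0⇒≡-∣∣ b (recompute (b ℤₚ.≤? 0ℤ) (ℤₚ.nonPositive⁻¹ b {{b≤0}})))
  where
  ≤0⇒≡-∣∣ : ∀ b → b ℤ.≤ 0ℤ → b ≡ ℤ.- (+ ∣ b ∣)
  ≤0⇒≡-∣∣ (+ zero)   _ = refl
  ≤0⇒≡-∣∣ (+ suc _)  (ℤ.+≤+ ())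
  ≤0⇒≡-∣∣ (-[1+ _ ]) _ = refl

-- In Gaps p bs q js, q is the first element of js followed by p, and the b's
-- are the (nonpositive) differences of consecutive elements of that list.

data Gaps (p : ℕ) : List ℤ≤0 → (q : ℕ) → List ℕ → Set where
  []  : Gaps p [] p []
  gap : Gaps p bs k js → c + q ≡ k → Gaps p (neg c ∷ bs) q (q ∷ js)

-- The differences telescope, which identifies the partial sums in `positions` with the entries of
-- `js`.
gaps⇒≡+sum : Gaps p bs q js → + q ≡ + p ℤ.+ sum bs
gaps⇒≡+sum []                              = sym (ℤₚ.+-identityʳ _)
gaps⇒≡+sum {p = p} (gap {bs = bs} {c = c} {q = q} G refl) = begin
  + q                                  ≡⟨ cancel (+ c) (+ q) ⟩
  ℤ.- (+ c) ℤ.+ (+ c ℤ.+ + q)          ≡⟨ cong (λ i → ℤ.- (+ c) ℤ.+ i) (gaps⇒≡+sum G) ⟩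
  ℤ.- (+ c) ℤ.+ (+ p ℤ.+ sum bs)       ≡⟨ swap (ℤ.- (+ c)) (+ p) (sum bs) ⟩
  + p ℤ.+ (ℤ.- (+ c) ℤ.+ sum bs)       ∎
  where
  open ≡-Reasoning
  cancel : ∀ c q → q ≡ ℤ.- c ℤ.+ (c ℤ.+ q)
  cancel = solve-∀
  swap : ∀ b p s → b ℤ.+ (p ℤ.+ s) ≡ p ℤ.+ (b ℤ.+ s)
  swap = solve-∀

gaps⇒laterPositions : Gaps p bs q js → laterPositions p bs ≡ js
gaps⇒laterPositions []             = refl
gaps⇒laterPositions G@(gap G′ _) =
  cong₂ _∷_ (cong ∣_∣ (sym (gaps⇒≡+sum G))) (gaps⇒laterPositions G′)

gaps⇒length : Gaps p bs q js → length js ≡ length bs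
gaps⇒length []         = refl
gaps⇒length (gap G _) = cong suc (gaps⇒length G)

gaps⇒sorted : Gaps p bs q js → q ≤ p × All (q ≤_) js × All (_≤ p) js × AllPairs _≤_ js
gaps⇒sorted []                       = ≤-refl , [] , [] , []
gaps⇒sorted (gap {c = c} {q = q} G refl) =
  let (k≤p , k≤js , js≤p , js↗) = gaps⇒sorted G
      q≤k                       = m≤n+m q c
      q≤js                      = All.map (≤-trans q≤k) k≤js
      q≤p                       = ≤-trans q≤k k≤p
  in q≤p , ≤-refl ∷ q≤js , q≤p ∷ js≤p , q≤js ∷ js↗

gaps-unique : Gaps p bs q js → Gaps p bs′ q′ js → bs ≡ bs′ × q ≡ q′
gaps-unique []           []            = refl , refl
gaps-unique (gap G c+q) (gap G′ c′+q) with refl , refl ← gaps-unique G G′ =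
  cong (λ c → neg c ∷ _) (+-cancelʳ-≡ _ _ _ (trans c+q (sym c′+q))) , refl

-- Only the leftmost position must be known to be natural: each further one arises by adding some
-- `c`.
gaps-of-steps : ∀ bs q → + q ≡ + p ℤ.+ sum bs → ∃[ js ] Gaps p bs q js
gaps-of-steps []       q q≡ with refl ← ℤₚ.+-injective (trans q≡ (ℤₚ.+-identityʳ _)) = [] , []
gaps-of-steps {p} (b ∷ bs) q q≡ with c , refl ← neg-surjective b =
  let (js , G) = gaps-of-steps bs (c + q)
                   (trans (cong (λ i → + c ℤ.+ i) q≡) (cancel (+ c) (+ p) (sum bs)))
  in q ∷ js , gap G refl
  where
  cancel : ∀ c p s → c ℤ.+ (p ℤ.+ (ℤ.- c ℤ.+ s)) ≡ p ℤ.+ s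
  cancel = solve-∀

-- The last component makes `q` the greatest lower bound of `p` and `js`, so that the truncated
-- difference `q ∸ j` is exact when `j` is put in front.
gaps-of-positions : ∀ p js → AllPairs _≤_ js → All (_≤ p) js →
                    ∃₂ λ bs q → Gaps p bs q js × (∀ {k} → k ≤ p → All (k ≤_) js → k ≤ q)
gaps-of-positions p []       _             _            = [] , p , [] , λ k≤p _ → k≤p
gaps-of-positions p (j ∷ js) (j≤js ∷ js↗) (j≤p ∷ js≤p) =
  let (bs , q , G , glb) = gaps-of-positions p js js↗ js≤p
  in neg (q ∸ j) ∷ bs , j , gap G (m∸n+n≡m (glb j≤p j≤js)) , λ { _ (k≤j ∷ _) → k≤j }

-- Code p l a j js: a step labelled l inserts its entries at the positions
-- j ∷ js when the first descent is at p.  Shifting j to suc j absorbs the -1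
-- in j₁ = p̂ + b₁ + … + b_k - 1, and makes j < js out of suc j ≤ js.

data Code (p : ℕ) : Label → (a j : ℕ) → List ℕ → Set where
  rise : Code p (rise a) a p []
  fall : .{{_ : NonZero a}} → Gaps p (b ∷ bs) (suc j) (suc j ∷ js) →
         Code p (fall a (b ∷ bs)) a j js

code⇒sorted : Code p l a j js → j ≤ p × All (_≤ p) js × All (j <_) js × AllPairs _≤_ js
code⇒sorted rise               = ≤-refl , [] , [] , []
code⇒sorted (fall (gap G refl)) with gaps⇒sorted (gap G refl)
... | j<p , _ , _ ∷ js≤p , j<js ∷ js↗ = <⇒≤ j<p , js≤p , j<js , js↗

code⇒length : Code p l a j js → length (j ∷ js) ≡ labelSemilength l
code⇒length rise     = refl
code⇒length (fall G) = gaps⇒length G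

code⇒step : Code p l a j js → step l ≡ (+ a , + suc j ℤ.- + p)
code⇒step {p = p} rise = cong (_ ,_) (cancel 1ℤ (+ p))
  where
  cancel : ∀ i p → i ≡ (i ℤ.+ p) ℤ.- p
  cancel = solve-∀
code⇒step {p = p} (fall {b = b} {bs = bs} G) = cong (_ ,_)
  (trans (cancel (sum (b ∷ bs)) (+ p)) (cong (λ i → i ℤ.- + p) (sym (gaps⇒≡+sum G))))
  where
  cancel : ∀ s p → s ≡ (p ℤ.+ s) ℤ.- p
  cancel = solve-∀

-- A `rise` has `j = p`, while the gaps of a `fall` force `suc j ≤ p`.
code-unique : Code p l a j js → Code p l′ a j js → l ≡ l′
code-unique rise     rise      = refl
code-unique rise     (fall G)  = contradiction (proj₁ (gaps⇒sorted G)) (n≮n _)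
code-unique (fall G) rise      = contradiction (proj₁ (gaps⇒sorted G)) (n≮n _)
code-unique (fall G) (fall G′) with refl , _ ← gaps-unique G G′ = refl

-- If `j = p`, then `j < js ≤ p` leaves no further position and the label is a `rise`; if `j < p`,
-- the gaps starting at `suc j` give a `fall`.
code-of-positions : .{{_ : NonZero a}} → j ≤ p → All (_≤ p) js → All (j <_) js → AllPairs _≤_ js →
                    ∃[ l ] Code p l a j js
code-of-positions j≤p js≤p j<js js↗ with m≤n⇒m<n∨m≡n j≤p
code-of-positions _ []          []          _   | inj₂ refl = _ , rise
code-of-positions _ (j≤p ∷ _)   (p<j ∷ _)   _   | inj₂ refl = contradiction j≤p (<⇒≱ p<j)
code-of-positions {js = js} _ js≤p j<js js↗ | inj₁ j<p =
  let (bs , q , G , glb) = gaps-of-positions _ js js↗ js≤p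
  in _ , fall (gap G (m∸n+n≡m (glb j<p j<js)))

code⇒extend : Code p l a j js → fdes e ≡ p →
              extend e l ≡ insertAllAfter (maxEntry e + a) (j ∷ js) e
code⇒extend rise refl = refl
code⇒extend {a = a} {e = e} (fall G@(gap G′ _)) refl =
  cong (λ js → insertAllAfter (maxEntry e + a) js e)
    (cong₂ _∷_ (cong (λ i → ∣ i ℤ.- 1ℤ ∣) (sym (gaps⇒≡+sum G))) (gaps⇒laterPositions G′))

-- One step of the map as a relation between sequences.

record Shape (p v : ℕ) (e : List ℕ) : Set where
  constructor shape
  field
    peak     : Peak 0 p v e
    bounded  : Bounded 0 e
    avoiding : Avoiding e

  all≤v : All (_≤ v) e
  all≤v = peak⇒all≤v peak avoiding

  fdes≡p : fdes e ≡ p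
  fdes≡p = peak⇒fdes peak

  maxEntry≡v : maxEntry e ≡ v
  maxEntry≡v = max≈v⁺ (peak⇒v∈e peak) all≤v z≤n

shape-unique : Shape p v e → Shape q u e → p ≡ q × v ≡ u
shape-unique S T = trans (sym (Shape.fdes≡p S)) (Shape.fdes≡p T) ,
                   trans (sym (Shape.maxEntry≡v S)) (Shape.maxEntry≡v T)

-- The cases are split by whether the maximum grows, not by kind of label: a `rise` with positive
-- `a` is undone like a `fall`, by deleting all copies of `m`.
data Extension (p v : ℕ) (e : List ℕ) : Label → (q m : ℕ) → List ℕ → Set where
  level : Insertion v 0 (p ∷ []) e e′ → Extension p v e (rise 0) (suc p) v e′
  jump  : 0 < a → v + a ≡ m → Code p l a j js → Insertion m 0 (j ∷ js) e e′ →
          Extension p v e l (suc j) m e′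

jump⇒all<m : Shape p v e → 0 < a → v + a ≡ m → All (_< m) e
jump⇒all<m {v = v} S 0<a refl =
  All.map (λ x≤v → ≤-<-trans x≤v (m<m+n v 0<a)) (Shape.all≤v S)

extension⇒extend : Shape p v e → Extension p v e l q m e′ → extend e l ≡ e′
extension⇒extend {p} {v} {e} {e′ = e′} S (level I) = begin
  insertAfter (maxEntry e + 0) (fdes e) e ≡⟨ cong₂ (λ m q → insertAfter m q e) max+0≡v (Shape.fdes≡p S) ⟩
  insertAfter v p e                       ≡⟨ insertion⇒insertAllAfter [] refl I ⟩
  e′                                      ∎
  where
  open ≡-Reasoning
  max+0≡v = trans (+-identityʳ _) (Shape.maxEntry≡v S)
extension⇒extend {v = v} {e} {l} {e′ = e′} S (jump {a = a} {j = j} {js = js} _ refl C I) = begin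
  extend e l                                  ≡⟨ code⇒extend C (Shape.fdes≡p S) ⟩
  insertAllAfter (maxEntry e + a) (j ∷ js) e  ≡⟨ cong (λ v → insertAllAfter (v + a) (j ∷ js) e) (Shape.maxEntry≡v S) ⟩
  insertAllAfter (v + a) (j ∷ js) e           ≡⟨ insertion⇒insertAllAfter [] refl I ⟩
  e′                                          ∎
  where open ≡-Reasoning

extension⇒length : Extension p v e l q m e′ → length e′ ≡ length e + labelSemilength l
extension⇒length (level I)      = insertion⇒length I
extension⇒length {e = e} (jump _ _ C I) = trans (insertion⇒length I) (cong (λ k → length e + k) (code⇒length C))

extension⇒length< : Extension p v e l q m e′ → length e < length e′
extension⇒length< {e = e} (level I)      = subst (length e <_) (sym (insertion⇒length I)) (m<m+n _ (s≤s z≤n))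
extension⇒length< {e = e} (jump _ _ _ I) = subst (length e <_) (sym (insertion⇒length I)) (m<m+n _ (s≤s z≤n))

-- The step is the displacement of the pair (maximum, first descent), which is why height follows
-- rank.
extension⇒step : Extension p v e l q m e′ → step l ≡ (+ m ℤ.- + v , + q ℤ.- + p)
extension⇒step {p = p} {v = v} (level _) = cong₂ _,_ (sym (ℤₚ.+-inverseʳ (+ v))) (cancel 1ℤ (+ p))
  where
  cancel : ∀ i p → i ≡ (i ℤ.+ p) ℤ.- p
  cancel = solve-∀
extension⇒step {v = v} (jump {a = a} _ refl C _) =
  trans (code⇒step C) (cong (λ b → b , _) (cancel (+ v) (+ a)))
  where
  cancel : ∀ v a → a ≡ (v ℤ.+ a) ℤ.- v
  cancel = solve-∀

-- Rank, height and existence of extensions.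

rankOf : ℕ → ℕ → ℤ
rankOf p v = + p ℤ.- + v ℤ.- 1ℤ

rankOf≡ : ∀ p v → rankOf p v ≡ + p ℤ.- + suc v
rankOf≡ p v = assoc (+ p) (+ v) 1ℤ
  where
  assoc : ∀ p v i → p ℤ.- v ℤ.- i ≡ p ℤ.- (i ℤ.+ v)
  assoc = solve-∀

v<p⇒0≤rankOf : v < p → 0ℤ ℤ.≤ rankOf p v
v<p⇒0≤rankOf {v} {p} v<p = subst (0ℤ ℤ.≤_) (sym (rankOf≡ p v)) (ℤₚ.i≤j⇒0≤j-i (ℤ.+≤+ v<p))

0≤rankOf⇒v<p : 0ℤ ℤ.≤ rankOf p v → v < p
0≤rankOf⇒v<p {p} {v} 0≤ = ℤₚ.drop‿+≤+ (ℤₚ.0≤i-j⇒j≤i (subst (0ℤ ℤ.≤_) (rankOf≡ p v) 0≤))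

slope : Label → ℤ
slope l = proj₂ (step l) ℤ.- proj₁ (step l)

height-▷ : ∀ Q l → height (Q ▷ l) ≡ height Q ℤ.+ slope l
height-▷ Q l = regroup (proj₁ (endpoint Q)) (proj₂ (endpoint Q)) (proj₁ (step l)) (proj₂ (step l))
  where
  regroup : ∀ x y a b → (y ℤ.+ b) ℤ.- (x ℤ.+ a) ≡ (y ℤ.- x) ℤ.+ (b ℤ.- a)
  regroup = solve-∀

extension⇒rankOf : Extension p v e l q m e′ → rankOf q m ≡ rankOf p v ℤ.+ slope l
extension⇒rankOf {p} {v} {l = l} {q} {m} E =
  trans (regroup (+ p) (+ v) (+ q) (+ m) 1ℤ)
        (cong (λ s → rankOf p v ℤ.+ (proj₂ s ℤ.- proj₁ s)) (sym (extension⇒step E)))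
  where
  regroup : ∀ p v q m i → q ℤ.- m ℤ.- i ≡ (p ℤ.- v ℤ.- i) ℤ.+ ((q ℤ.- p) ℤ.- (m ℤ.- v))
  regroup = solve-∀

code-extension-exists : Shape p v e → 0 < a → Code p l a j js →
                        ∃[ e′ ] Extension p v e l (suc j) (v + a) e′
code-extension-exists {v = v} {e} {a} {j = j} {js = js} S 0<a C =
  let (j≤p , js≤p , j<js , js↗) = code⇒sorted C
      (e′ , I) = insertion-exists (v + a) 0 (j ∷ js) e (All.map <⇒≤ j<js ∷ js↗)
                   (All.universal (λ _ → z≤n) _)
                   (All.map (λ i≤p → ≤-trans i≤p (peak⇒p≤i+length (Shape.peak S))) (j≤p ∷ js≤p))
  in e′ , jump 0<a refl C I

-- Nonnegative height after the step means `p + s ≥ v + a + 1 ≥ 1`, so the leftmost position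
-- `p + s - 1` is natural.
positive-sum : ∀ p v a s → 0ℤ ℤ.≤ rankOf p v ℤ.+ (s ℤ.- + a) → ∃[ j ] + suc j ≡ + p ℤ.+ s
positive-sum p v a s 0≤ = positive (+ p ℤ.+ s)
  (ℤₚ.≤-trans (ℤ.+≤+ (s≤s z≤n)) (ℤₚ.0≤i-j⇒j≤i {+ p ℤ.+ s} {+ suc (v + a)}
    (subst (0ℤ ℤ.≤_) (regroup (+ p) (+ v) (+ a) s 1ℤ) 0≤)))
  where
  regroup : ∀ p v a s i → (p ℤ.- v ℤ.- i) ℤ.+ (s ℤ.- a) ≡ (p ℤ.+ s) ℤ.- (i ℤ.+ (v ℤ.+ a))
  regroup = solve-∀
  positive : ∀ t → 1ℤ ℤ.≤ t → ∃[ j ] + suc j ≡ t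
  positive (+ suc j) _ = j , refl
  positive (+ zero)  (ℤ.+≤+ ())

extension-exists : Shape p v e → ∀ l → 0ℤ ℤ.≤ rankOf p v ℤ.+ slope l →
                   ∃₂ λ q m → ∃[ e′ ] Extension p v e l q m e′
extension-exists {p} {v} {e} S (rise zero) _ =
  let (e′ , I) = insertion-exists v 0 (p ∷ []) e ([] ∷ []) (z≤n ∷ [])
                   (peak⇒p≤i+length (Shape.peak S) ∷ [])
  in suc p , v , e′ , level I
extension-exists S (rise (suc a)) _ = _ , _ , code-extension-exists S (s≤s z≤n) rise
extension-exists {p} {v} S (fall a (b ∷ bs)) 0≤
  with j , j≡ ← positive-sum p v a (sum (b ∷ bs)) 0≤
  with _ , G@(gap _ _) ← gaps-of-steps (b ∷ bs) (suc j) j≡ =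
  _ , _ , code-extension-exists S (>-nonZero⁻¹ a) (fall G)

peak⇒ascending-from-0 : Peak i p v e → Ascending 0 i p e
peak⇒ascending-from-0 {e = _ ∷ _} P = z≤n ∷ peak⇒ascending P

jump⇒summit : Shape p v e → m < suc j → 0 < a → v + a ≡ m → Code p l a j js →
              Insertion m 0 (j ∷ js) e e′ → ∃[ u ] u < m × Summit 0 (suc j) u m e′
jump⇒summit {v = v} {a = a} S (s≤s m≤j) 0<a refl C I =
  let (j≤p , _ , j<js , _) = code⇒sorted C
  in jump-insertion⇒summit I (jump⇒all<m S 0<a refl) (Shape.peak S)
       -- From `0 < a ≤ v + a ≤ j`, some entry precedes the first copy of `m`.
       (<-≤-trans (<-≤-trans 0<a (m≤n+m a v)) m≤j) j<js j≤p

-- Nonnegativity of the new rank, `m < q`, says that `m` is at most the leftmost insertion position,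
-- as the bound on its copies demands.
extension⇒shape : Shape p v e → Extension p v e l q m e′ → m < q → Shape q m e′
extension⇒shape S@(shape P B A) (level I) (s≤s v≤p) = shape
  (summit⇒peak (level-insertion⇒summit I P))
  (insertion-bounded I z≤n (v≤p ∷ []) B)
  (insertion-avoiding I (≤-refl ∷ []) (peak⇒ascending-from-0 P) (Shape.all≤v S) A)
extension⇒shape S@(shape P B A) (jump 0<a v+a≡m C I) m<1+j@(s≤s m≤j) =
  let (j≤p , js≤p , j<js , _) = code⇒sorted C
      (_ , _ , summit)           = jump⇒summit S m<1+j 0<a v+a≡m C I
  in shape
    (summit⇒peak summit)
    (insertion-bounded I z≤n (m≤j ∷ All.map (λ j<i → ≤-trans m≤j (<⇒≤ j<i)) j<js) B)
    (insertion-avoiding I (j≤p ∷ js≤p) (peak⇒ascending-from-0 P)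
       (All.map <⇒≤ (jump⇒all<m S 0<a v+a≡m)) A)

-- Uniqueness and existence of the last step.

-- Whether the entry before the peak equals it tells a level extension from a jump.

extension-injective-at-peak : Shape p v e₁ → Shape q u e₂ → m < n →
                      Extension p v e₁ l n m e′ → Extension q u e₂ l′ n m e′ →
                      e₁ ≡ e₂ × l ≡ l′
extension-injective-at-peak S T _ (level I) (level J) = insertion-source-unique I J , refl
extension-injective-at-peak S T m<n (level I) (jump 0<a ≡m C J) =
  let (_ , u<m , summit) = jump⇒summit T m<n 0<a ≡m C J
  in contradiction (summit-unique summit (level-insertion⇒summit I (Shape.peak S))) (<⇒≢ u<m)
extension-injective-at-peak S T m<n (jump 0<a ≡m C J) (level I) =
  let (_ , u<m , summit) = jump⇒summit S m<n 0<a ≡m C J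
  in contradiction (summit-unique summit (level-insertion⇒summit I (Shape.peak T))) (<⇒≢ u<m)
extension-injective-at-peak {v = v} S T _ (jump {a = a} 0<a v+a≡m C I) (jump {a = a′} 0<a′ u+a′≡m D J)
  with refl , refl ← removal-unique (jump⇒all<m S 0<a v+a≡m) (jump⇒all<m T 0<a′ u+a′≡m) I J
  with refl , refl ← shape-unique S T
  with refl ← +-cancelˡ-≡ v a a′ (trans v+a≡m (sym u+a′≡m)) =
  refl , code-unique C D

extension-injective : Shape p v e₁ → Shape q u e₂ → m < n → x < y →
                      Extension p v e₁ l n m e′ → Extension q u e₂ l′ y x e′ →
                      e₁ ≡ e₂ × l ≡ l′
extension-injective S T m<n x<y E E′
  with refl , refl ← shape-unique (extension⇒shape S E m<n) (extension⇒shape T E′ x<y) =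
  extension-injective-at-peak S T m<n E E′

extension-surjective : Shape q m (x ∷ y ∷ e′) →
  ∃₂ λ p v → ∃₂ λ e l → Shape p v e × Extension p v e l q m (x ∷ y ∷ e′)
extension-surjective S@(shape P B@(x≤0 ∷ _) A)
  with u , summit ← peak⇒summit P (≤-trans x≤0 z≤n)
  with m≤n⇒m<n∨m≡n (summit⇒u≤v summit)
... | inj₂ refl with _ , _ , refl , I , P′ ← summit⇒level-insertion summit =
  _ , _ , _ , _ ,
  shape P′ (removal-bounded I (removal-all I (Shape.all≤v S)) B) (removal-avoiding I A) , level I
... | inj₁ u<m with removal-exists 0 (Shape.all≤v S)
-- With nothing left after the removal, the first entry would be `m`, but it is at most `u < m`.
...   | _ , [] , here _ , _ = contradiction (summit⇒head≤u summit) (<⇒≱ u<m)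
...   | js , x ∷ e , I , <m
  with j , js′ , refl , refl , j<js ← summit⇒jump-insertion I <m summit u<m
  with p , v , P′ ← peak-exists 0 x e
  with j≤p ∷ js≤p ← insertion-avoiding⇒≤p I <m P′ A
  with _ ∷ js↗ ← insertion⇒sorted I =
  let v<m     = All.lookup <m (peak⇒v∈e P′)
      -- The growth `m ∸ v` of the maximum is the horizontal part of the step.
      0<m∸v   = m<n⇒0<n∸m v<m
      (l , C) = code-of-positions {{>-nonZero 0<m∸v}} j≤p js≤p j<js js↗
  in p , v , x ∷ e , l ,
     shape P′ (removal-bounded I (All.map <⇒≤ <m) B) (removal-avoiding I A) ,
     jump 0<m∸v (m+[n∸m]≡n (<⇒≤ v<m)) C I

-- Induction along paths.

weaklyAbove⇒0≤height : ∀ Q → WeaklyAbove (endpoint Q) → 0ℤ ℤ.≤ height Q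
weaklyAbove⇒0≤height Q = ℤₚ.i≤j⇒0≤j-i

0≤height⇒weaklyAbove : ∀ Q → 0ℤ ℤ.≤ height Q → WeaklyAbove (endpoint Q)
0≤height⇒weaklyAbove Q = ℤₚ.0≤i-j⇒j≤i

-- The induction invariant: `height≡` turns the diagonal condition on the next endpoint into the
-- nonnegative rank that extending requires.
record Image (Q : Path) (p v : ℕ) : Set where
  constructor image
  field
    φ-shape  : Shape p v (φ Q)
    height≡  : height Q ≡ rankOf p v
    φ-length : length (φ Q) ≡ suc (semilength Q)

  height≡rank : height Q ≡ rank (φ Q)
  height≡rank = trans height≡
    (sym (cong₂ rankOf (Shape.fdes≡p φ-shape) (Shape.maxEntry≡v φ-shape)))

extension⇒height : ∀ Q → height Q ≡ rankOf p v → Extension p v e l q m e′ →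
                   height (Q ▷ l) ≡ rankOf q m
extension⇒height {l = l} Q h≡ E =
  trans (height-▷ Q l) (trans (cong (λ h → h ℤ.+ slope l) h≡) (sym (extension⇒rankOf E)))

record LastStep (Q : Path) (l : Label) (q m : ℕ) : Set where
  field
    {p₀ v₀}   : ℕ
    before    : Image Q p₀ v₀
    m<q       : m < q
    extension : Extension p₀ v₀ (φ Q) l q m (φ (Q ▷ l))

lastStep⇒image : ∀ Q l → LastStep Q l q m → Image (Q ▷ l) q m
lastStep⇒image Q l L = image
  (extension⇒shape (Image.φ-shape before) extension m<q)
  (extension⇒height Q (Image.height≡ before) extension)
  (trans (extension⇒length extension) (cong (λ k → k + labelSemilength l) (Image.φ-length before)))
  where open LastStep L

lastStep-injective : LastStep Q l q m → LastStep Q′ l′ p v → φ (Q ▷ l) ≡ φ (Q′ ▷ l′) →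
                     φ Q ≡ φ Q′ × l ≡ l′
lastStep-injective L L′ φ≡ = extension-injective (Image.φ-shape L.before) (Image.φ-shape L′.before)
  L.m<q L′.m<q L.extension (subst (Extension _ _ _ _ _ _) (sym φ≡) L′.extension)
  where
  module L  = LastStep L
  module L′ = LastStep L′

mutual
  -- The height of the endpoint enters twice: as old rank plus slope it makes the positions
  -- legitimate, and as new rank it gives `m < q`.
  φ-lastStep : NotBelowDiagonal (Q ▷ l) → ∃₂ λ q m → LastStep Q l q m
  φ-lastStep {Q} {l} (next N above) =
    let (p , v , before) = φ-image N
        S                = Image.φ-shape before
        0≤h              = weaklyAbove⇒0≤height (Q ▷ l) above
        (q , m , e′ , E) = extension-exists S l
          (subst (0ℤ ℤ.≤_) (trans (height-▷ Q l) (cong (λ h → h ℤ.+ slope l) (Image.height≡ before))) 0≤h)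
    in q , m , record
      { before    = before
      ; m<q       = 0≤rankOf⇒v<p (subst (0ℤ ℤ.≤_) (extension⇒height Q (Image.height≡ before) E) 0≤h)
      ; extension = subst (Extension p v (φ Q) l q m) (sym (extension⇒extend S E)) E
      }

  φ-image : NotBelowDiagonal Q → ∃₂ λ p v → Image Q p v
  φ-image start              = 1 , 0 , image (shape end (z≤n ∷ []) ([] ∷ [])) refl refl
  φ-image {Q ▷ l} N@(next _ _) = let (q , m , L) = φ-lastStep N in q , m , lastStep⇒image Q l L

φ-▷≢φ-ε : NotBelowDiagonal (Q ▷ l) → length (φ (Q ▷ l)) ≢ 1
φ-▷≢φ-ε {Q} N len≡1 =
  let (_ , _ , L) = φ-lastStep N
      open LastStep L
  in contradiction (subst (length (φ Q) <_) len≡1 (extension⇒length< extension))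
       (≤⇒≯ (subst (1 ≤_) (sym (Image.φ-length before)) (s≤s z≤n)))

φ-injective : NotBelowDiagonal Q → NotBelowDiagonal Q′ → φ Q ≡ φ Q′ → Q ≡ Q′
φ-injective start          start          _  = refl
φ-injective start          N′@(next _ _)  φ≡ = contradiction (cong length (sym φ≡)) (φ-▷≢φ-ε N′)
φ-injective N@(next _ _)   start          φ≡ = contradiction (cong length φ≡) (φ-▷≢φ-ε N)
φ-injective {Q ▷ l} {Q′ ▷ l′} N@(next N₀ _) N′@(next N₀′ _) φ≡ =
  let (_ , _ , L)  = φ-lastStep N
      (_ , _ , L′) = φ-lastStep N′
      (φ₀≡ , l≡)   = lastStep-injective L L′ φ≡
  in cong₂ _▷_ (φ-injective N₀ N₀′ φ₀≡) l≡

-- The bound `n` on the length drives the recursion, since the sequence before the last step is not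
-- a subterm of `e`.
φ-surjective : ∀ n e → length e ≤ suc n → Shape p v e → ∃[ Q ] NotBelowDiagonal Q × φ Q ≡ e
φ-surjective n       []          _         S with () ← Shape.peak S
φ-surjective n       (zero ∷ []) _         _ = ε , start , refl
φ-surjective n       (suc _ ∷ []) _        (shape _ (() ∷ _) _)
φ-surjective (suc n) (x ∷ y ∷ e) (s≤s len≤) S
  with p , v , e₀ , l , S₀ , E ← extension-surjective S
  with Q , N , refl ← φ-surjective n e₀ (≤-trans (s≤s⁻¹ (extension⇒length< E)) len≤) S₀
  with p′ , v′ , I ← φ-image N
  with refl , refl ← shape-unique S₀ (Image.φ-shape I) =
  Q ▷ l ,
  next N (0≤height⇒weaklyAbove (Q ▷ l) (subst (0ℤ ℤ.≤_) (sym (extension⇒height Q (Image.height≡ I) E))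
    (v<p⇒0≤rankOf (peak⇒v<p (Shape.peak S) (Shape.bounded S))))) ,
  extension⇒extend S₀ E

-- Passage to the conditions stated by indices.

bounded⇒lookup : Bounded i e → ∀ (j : Fin (length e)) → lookup e j ≤ i + toℕ j
bounded⇒lookup {i} (x≤i ∷ _) zero    = ≤-trans x≤i (m≤m+n i 0)
bounded⇒lookup {i} (_ ∷ B)   (suc j) = ≤-trans (bounded⇒lookup B j) (≤-reflexive (sym (+-suc i _)))

lookup⇒bounded : ∀ e → (∀ (j : Fin (length e)) → lookup e j ≤ i + toℕ j) → Bounded i e
lookup⇒bounded     []      _ = []
lookup⇒bounded {i} (x ∷ e) b =
  subst (x ≤_) (+-identityʳ i) (b zero) ∷
  lookup⇒bounded e (λ j → ≤-trans (b (suc j)) (≤-reflexive (+-suc i _)))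

allPairs⇒lookup : ∀ {R : ℕ → ℕ → Set} → AllPairs R e → ∀ {j k : Fin (length e)} →
                  j Fin.< k → R (lookup e j) (lookup e k)
allPairs⇒lookup (r ∷ _)  {zero}  {suc k} _         = All.lookup r (∈-lookup k)
allPairs⇒lookup (_ ∷ rs) {suc j} {suc k} (s≤s j<k) = allPairs⇒lookup rs j<k

avoiding⇒lookup : Avoiding e → Avoids102 e
avoiding⇒lookup (r ∷ _) zero    (suc j) (suc k) _         (s≤s j<k) = allPairs⇒lookup r j<k
avoiding⇒lookup (_ ∷ A) (suc i) (suc j) (suc k) (s≤s i<j) (s≤s j<k) = avoiding⇒lookup A i j k i<j j<k

lookup⇒avoiding : ∀ e → Avoids102 e → Avoiding e
lookup⇒avoiding []      _ = []
lookup⇒avoiding (x ∷ e) a =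
  subst (No02Around x) (List.tabulate-lookup e)
    (tabulate⁺-< (λ {j} {k} j<k → a zero (suc j) (suc k) (s≤s z≤n) (s≤s j<k))) ∷
  lookup⇒avoiding e (λ i j k i<j j<k → a (suc i) (suc j) (suc k) (s≤s i<j) (s≤s j<k))

isIS102⇒shape : IsIS102 (suc n) e → ∃₂ λ p v → Shape p v e
isIS102⇒shape {e = x ∷ e} (_ , b , a) =
  let (p , v , P) = peak-exists 0 x e
  in p , v , shape P (lookup⇒bounded (x ∷ e) b) (lookup⇒avoiding (x ∷ e) a)

φ-mapsLFtoIS102 : MapsLFtoIS102
φ-mapsLFtoIS102 n (N , refl) =
  let (_ , _ , image (shape _ B A) _ len) = φ-image N
  in len , bounded⇒lookup B , avoiding⇒lookup A

-- Irrelevant proofs and the bijection on the unions.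

isIS102-recompute : Recomputable (IsIS102 n e)
isIS102-recompute =
  recompute (_ ≟ _) ×-recompute
  (Π-recompute _ (λ _ → recompute (_ ≤? _)) ×-recompute
   (λ a i j k i<j j<k → ¬-recompute (a i j k i<j j<k)))

notBelowDiagonal-init : NotBelowDiagonal (Q ▷ l) → NotBelowDiagonal Q
notBelowDiagonal-init (next N _) = N

notBelowDiagonal-last : NotBelowDiagonal (Q ▷ l) → WeaklyAbove (endpoint (Q ▷ l))
notBelowDiagonal-last (next _ above) = above

-- An irrelevant proof cannot be matched on, so the recursion is on the path.
notBelowDiagonal-recompute : ∀ Q → Recomputable (NotBelowDiagonal Q)
notBelowDiagonal-recompute ε       _ = start
notBelowDiagonal-recompute (Q ▷ l) N =
  next (notBelowDiagonal-recompute Q (notBelowDiagonal-init N))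
       (recompute (_ ℤₚ.≤? _) (notBelowDiagonal-last N))

-- The index is the semilength, hence determined by the path.
⋃LF-≡ : {Q Q′ : ⋃LF} → value (proj₂ Q) ≡ value (proj₂ Q′) → Q ≡ Q′
⋃LF-≡ {_ , Q , [ lf ]} {_ , _ , [ lf′ ]} refl
  with refl ← recompute (_ ≟ _) (trans (sym (proj₂ lf)) (proj₂ lf′)) = refl

⋃IS102-≡ : {e e′ : ⋃IS102} → value (proj₂ e) ≡ value (proj₂ e′) → e ≡ e′
⋃IS102-≡ {_ , e , [ is ]} {_ , _ , [ is′ ]} refl
  with refl ← recompute (_ ≟ _) (suc-injective (trans (sym (proj₁ is)) (proj₁ is′))) = refl

theorem3p1 : Σ[ wd ∈ MapsLFtoIS102 ]
    ( Bijective _≡_ _≡_ (φ-on-⋃LF wd)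
    × (∀ (Q : ⋃LF) → height (value (proj₂ Q)) ≡ rank (value (proj₂ (φ-on-⋃LF wd Q)))) )
theorem3p1 = φ-mapsLFtoIS102 , (injective , strictlySurjective⇒surjective surjective) , height≡rank
  where
  notBelow : (Q : ⋃LF) → NotBelowDiagonal (value (proj₂ Q))
  notBelow (_ , Q , [ lf ]) = notBelowDiagonal-recompute Q (proj₁ lf)

  injective : Injective _≡_ _≡_ (φ-on-⋃LF φ-mapsLFtoIS102)
  injective {Q} {Q′} φ≡ =
    ⋃LF-≡ (φ-injective (notBelow Q) (notBelow Q′) (cong (value ∘ proj₂) φ≡))

  surjective : StrictlySurjective _≡_ (φ-on-⋃LF φ-mapsLFtoIS102)
  surjective (n , e , [ is ]) =
    let (_ , _ , S) = isIS102⇒shape (isIS102-recompute {suc n} {e} is)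
        (Q , N , φ≡) = φ-surjective (length e) e (n≤1+n _) S
    in (semilength Q , Q , [ N , refl ]) , ⋃IS102-≡ φ≡

  height≡rank : (Q : ⋃LF) → height (value (proj₂ Q)) ≡ rank (φ (value (proj₂ Q)))
  height≡rank Q = let (_ , _ , I) = φ-image (notBelow Q) in Image.height≡rank I
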